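{- There exists $n_2$ such that for every $P^3_3$-free $3$-graph $H$ with $n\ge n_2$ vertices and $m\ge n^2/8+1$ edges we have $\Delta(H)\ge n^2/32-n$. On the other hand, for every $n\ge 4$ there exists a $P^3_3$-free $3$-graph $H_0$ with $n$ vertices, $m=\lfloor n^2/8\rfloor$ edges and $\Delta(H_0)\le \lceil n/2\rceil$.
   Context: A $k$-graph $H=(V,E)$ is a family $E$ of (distinct) $k$-element subsets (edges) of a finite vertex set $V$. The degree of a vertex is the number of edges containing it, and $\Delta(H)$ is the maximum degree. The loose path $P^k_\ell$ is the connected linear $k$-graph with $\ell$ edges and $k\ell-\ell+1$ vertices; in particular $P^3_3$ consists of three $3$-element edges $e_1,e_2,e_3$ with $|e_1\cap e_2|=|e_2\cap e_3|=1$ and $e_1\cap e_3=\emptyset$. $H$ is $P^k_\ell$-free if it contains no (not necessarily induced) copy of $P^k_\ell$. -}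

module Defs where

open import Data.Nat using (ℕ; _⊔_)
open import Data.Fin using (Fin)
open import Data.Fin.Subset using (Subset; ∣_∣; _∩_; _∈_)
open import Data.Fin.Subset.Properties using (_∈?_)
open import Data.List using (List; length; filter; map; foldr; allFin)
open import Data.List.Relation.Unary.All using (All)
open import Data.List.Relation.Unary.Unique.Propositional using (Unique)
open import Data.List.Membership.Propositional renaming (_∈_ to _∈ˡ_)
open import Data.Product using (_×_; ∃-syntax)
open import Relation.Binary.PropositionalEquality using (_≡_)
open import Relation.Nullary using (¬_)

record ThreeGraph (n : ℕ) : Set where
  field
    edges    : List (Subset n)
    uniform  : All (λ e → ∣ e ∣ ≡ 3) edges
    distinct : Unique edges
open ThreeGraph public

numEdges : ∀ {n} → ThreeGraph n → ℕ
numEdges H = length (edges H)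

degree : ∀ {n} → ThreeGraph n → Fin n → ℕ
degree H v = length (filter (λ e → v ∈? e) (edges H))

maxDegree : ∀ {n} → ThreeGraph n → ℕ
maxDegree {n} H = foldr _⊔_ 0 (map (degree H) (allFin n))

ContainsP33 : ∀ {n} → ThreeGraph n → Set
ContainsP33 H = ∃[ e₁ ] ∃[ e₂ ] ∃[ e₃ ]
  (e₁ ∈ˡ edges H × e₂ ∈ˡ edges H × e₃ ∈ˡ edges H ×
   ∣ e₁ ∩ e₂ ∣ ≡ 1 × ∣ e₂ ∩ e₃ ∣ ≡ 1 × ∣ e₁ ∩ e₃ ∣ ≡ 0)

P33Free : ∀ {n} → ThreeGraph n → Set
P33Free H = ¬ ContainsP33 H

{-# OPTIONS --safe #-}
module Submission where

open import Data.Nat using (ℕ; _+_; _*_; _/_; _≤_)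
open import Data.Product using (_×_; ∃-syntax)
open import Relation.Binary.PropositionalEquality using (_≡_)
open import Defs
open import Algebra.Properties.CommutativeSemigroup using (x∙yz≈y∙xz)
open import Data.Nat using (zero; suc; _∸_; _<_; z≤n; s≤s; _≤?_; _⊔_; _%_)
open import Data.Nat.Properties hiding (_≟_)
open import Data.Nat.DivMod
  using (m/n*n≤m; m*n/n≡m; +-distrib-/-∣ʳ; m<n⇒m/n≡0; /-monoˡ-≤; m≡m%n+[m/n]*n; m%n<n)
open import Data.Nat.Divisibility using (n∣m*n)
open import Data.Nat.ListAction using (sum)
open import Data.Nat.Solver using (module +-*-Solver)
open import Data.Fin using (Fin; zero; suc; _↑ˡ_; _↑ʳ_; splitAt)
open import Data.Fin.Properties using (_≟_; splitAt⁻¹-↑ˡ; splitAt⁻¹-↑ʳ) renaming (any? to anyFin?)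
open import Data.Fin.Subset using (Subset; ∣_∣; _∩_; _∈_; _∉_; ⁅_⁆; inside; outside; Nonempty)
open import Data.Fin.Subset.Properties
open import Data.Vec using (_∷_; []; here; there) renaming (_++_ to _++ᵛ_)
open import Data.Vec.Properties using (zipWith-++)
open import Data.List using (List; []; _∷_; length; filter; map; foldr; allFin; cartesianProductWith)
open import Data.List.Properties
  using (length-filter; filter-notAll; filter-some; length-tabulate; length-map; length-++)
open import Data.List.Relation.Unary.All as All using (All; []; _∷_)
open import Data.List.Relation.Unary.Any using (here; there; any?)
open import Data.List.Relation.Unary.AllPairs using (_∷_)
open import Data.List.Relation.Unary.Unique.Propositional using (Unique)
import Data.List.Relation.Unary.Unique.Propositional.Properties as Uniqueₚ
open import Data.List.Membership.Propositional using (find; lose) renaming (_∈_ to _∈ˡ_)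
open import Data.List.Membership.Propositional.Properties
  using (∈-filter⁺; ∈-filter⁻; ∈-allFin; ∈-map⁺; ∈-map⁻; ∈-cartesianProductWith⁻)
open import Data.Product using (_,_; proj₁; proj₂; swap)
open import Data.Sum as Sum using (_⊎_; inj₁; inj₂)
open import Data.Empty using (⊥-elim) renaming (⊥ to False)
open import Function using (_∘_; id)
open import Relation.Nullary using (¬_; Dec; yes; no; contradiction)
open import Relation.Nullary.Decidable using (_×-dec_; ¬?; map′; decidable-stable)
open import Relation.Unary using (Decidable)
open import Relation.Binary.PropositionalEquality using (_≢_; refl; sym; trans; cong; cong₂; subst; subst₂; ≢-sym)

-- If H is a counterexample with more than n²/8 edges, a minimal vertex set W spanning more than
-- |W| n / 8 edges has the property that every nonempty P ⊆ W is touched by more than |P| n / 8 of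
-- them; in particular all degrees are large.  Call a pair thick if it lies in at least 11 edges.
-- A vertex with two thick partners is the centre of a star on s leaves that no edge leaves except
-- through the centre; applying the property to the leaves gives s > n / 4, so the centre has
-- degree above n²/32.  Otherwise the thick pairs are disjoint, and every edge consists of a thick
-- pair and an unpaired vertex, so there are at most |W|²/8 ≤ |W| n / 8 edges, a contradiction.

private variable
  n k : ℕ
  A : Set

-- Counting in lists

filter-filter : {P Q : A → Set} (P? : Decidable P) (Q? : Decidable Q) (xs : List A) →
  filter Q? (filter P? xs) ≡ filter (λ x → P? x ×-dec Q? x) xs
filter-filter P? Q? [] = refl
filter-filter P? Q? (x ∷ xs) with P? x
... | no  _ = filter-filter P? Q? xs
... | yes _ with Q? x
...   | no  _ = filter-filter P? Q? xs
...   | yes _ = cong (x ∷_) (filter-filter P? Q? xs)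

length-filter-mono : {P Q : A → Set} (P? : Decidable P) (Q? : Decidable Q) (xs : List A) →
  (∀ {x} → x ∈ˡ xs → P x → Q x) → length (filter P? xs) ≤ length (filter Q? xs)
length-filter-mono P? Q? [] P⊆Q = z≤n
length-filter-mono P? Q? (x ∷ xs) P⊆Q with P? x | Q? x
... | no  _ | no  _ = length-filter-mono P? Q? xs (P⊆Q ∘ there)
... | no  _ | yes _ = m≤n⇒m≤1+n (length-filter-mono P? Q? xs (P⊆Q ∘ there))
... | yes p | no ¬q = contradiction (P⊆Q (here refl) p) ¬q
... | yes _ | yes _ = s≤s (length-filter-mono P? Q? xs (P⊆Q ∘ there))

length-filter-¬ : {P : A → Set} (P? : Decidable P) (xs : List A) →
  length (filter P? xs) + length (filter (λ x → ¬? (P? x)) xs) ≡ length xs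
length-filter-¬ P? [] = refl
length-filter-¬ P? (x ∷ xs) with P? x
... | yes _ = cong suc (length-filter-¬ P? xs)
... | no  _ = trans (+-suc _ _) (cong suc (length-filter-¬ P? xs))

length≤1 : {xs : List A} → Unique xs → (∀ {x y} → x ∈ˡ xs → y ∈ˡ xs → x ≡ y) → length xs ≤ 1
length≤1 {xs = []} _ _ = z≤n
length≤1 {xs = _ ∷ []} _ _ = s≤s z≤n
length≤1 {xs = _ ∷ _ ∷ _} ((x≢y ∷ _) ∷ _) eq = contradiction (eq (here refl) (there (here refl))) x≢y

2≤length : {xs : List A} {x y : A} → x ∈ˡ xs → y ∈ˡ xs → x ≢ y → 2 ≤ length xs
2≤length (here refl) (here refl) x≢y = contradiction refl x≢y
2≤length {xs = _ ∷ _ ∷ _} _ (there _) _ = s≤s (s≤s z≤n)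
2≤length {xs = _ ∷ _ ∷ _} (there _) (here _) _ = s≤s (s≤s z≤n)

sum-map-≤ : (f : A → ℕ) (xs : List A) {d : ℕ} → (∀ {x} → x ∈ˡ xs → f x ≤ d) →
  sum (map f xs) ≤ length xs * d
sum-map-≤ f [] f≤d = z≤n
sum-map-≤ f (x ∷ xs) f≤d = +-mono-≤ (f≤d (here refl)) (sum-map-≤ f xs (f≤d ∘ there))

deg : Fin n → List (Subset n) → ℕ
deg v F = length (filter (v ∈?_) F)

hits : List (Fin n) → Subset n → ℕ
hits V e = length (filter (_∈? e) V)

sum-deg-∷ : (V : List (Fin n)) (e : Subset n) (F : List (Subset n)) →
  sum (map (λ v → deg v (e ∷ F)) V) ≡ hits V e + sum (map (λ v → deg v F) V)
sum-deg-∷ [] e F = refl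
sum-deg-∷ (v ∷ V) e F with v ∈? e
... | no  _ = trans (cong (deg v F +_) (sum-deg-∷ V e F)) (x∙yz≈y∙xz +-commutativeSemigroup (deg v F) (hits V e) _)
... | yes _ = cong suc (trans (cong (deg v F +_) (sum-deg-∷ V e F)) (x∙yz≈y∙xz +-commutativeSemigroup (deg v F) (hits V e) _))

hits-≤-sum-deg : (V : List (Fin n)) (F : List (Subset n)) →
  (∀ {e} → e ∈ˡ F → k ≤ hits V e) → length F * k ≤ sum (map (λ v → deg v F) V)
hits-≤-sum-deg V [] _ = z≤n
hits-≤-sum-deg V (e ∷ F) k≤ = ≤-trans
  (+-mono-≤ (k≤ (here refl)) (hits-≤-sum-deg V F (k≤ ∘ there)))
  (≤-reflexive (sym (sum-deg-∷ V e F)))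

-- Incidences between `V` and `F`, counted once from the edges and once from the vertices. Most edge
-- counts below rest on this inequality.
double-count : (V : List (Fin n)) (F : List (Subset n)) {k d : ℕ} →
  (∀ {e} → e ∈ˡ F → k ≤ hits V e) → (∀ {v} → v ∈ˡ V → deg v F ≤ d) →
  length F * k ≤ length V * d
double-count V F k≤ ≤d = ≤-trans (hits-≤-sum-deg V F k≤) (sum-map-≤ _ V ≤d)

1≤hits : {V : List (Fin n)} {e : Subset n} {v : Fin n} → v ∈ˡ V → v ∈ e → 1 ≤ hits V e
1≤hits {e = e} v∈V v∈e = filter-some (_∈? e) (lose v∈V v∈e)

2≤hits : {V : List (Fin n)} {e : Subset n} {u v : Fin n} →
  u ∈ˡ V → u ∈ e → v ∈ˡ V → v ∈ e → u ≢ v → 2 ≤ hits V e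
2≤hits {e = e} u∈V u∈e v∈V v∈e =
  2≤length (∈-filter⁺ (_∈? e) u∈V u∈e) (∈-filter⁺ (_∈? e) v∈V v∈e)

-- Union bound: together the vertices of `V` meet at most `length V * d` edges, so the longer list
-- `F` has an edge missing them all.
avoid : (V : List (Fin n)) (F : List (Subset n)) {d : ℕ} →
  All (λ v → deg v F ≤ d) V → length V * d < length F → ∃[ e ] (e ∈ˡ F × All (_∉ e) V)
avoid V F {d} ≤d V<F with any? (λ e → ¬? (any? (_∈? e) V)) F
... | yes some = let e , e∈F , misses = find some in
  e , e∈F , All.tabulate (λ v∈V v∈e → misses (lose v∈V v∈e))
... | no none = contradiction V<F (≤⇒≯ (subst (_≤ length V * d) (*-identityʳ _)
  (double-count V F meets (All.lookup ≤d))))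
  where
  meets : ∀ {e} → e ∈ˡ F → 1 ≤ hits V e
  meets {e} e∈F = filter-some (_∈? e)
    (decidable-stable (any? (_∈? e) V) (λ misses → none (lose e∈F misses)))

deg-filter-≤ : {P : Subset n → Set} (P? : Decidable P) (v : Fin n) (E : List (Subset n)) →
  deg v (filter P? E) ≤ deg v E
deg-filter-≤ P? v E = ≤-trans (≤-reflexive (cong length (filter-filter P? (v ∈?_) E)))
  (length-filter-mono _ (v ∈?_) E (λ _ → proj₂))

-- Supplies the bound `d = 1` for `avoid` and `double-count` whenever `v` together with `P` pins an
-- edge down.
deg-filter≤1 : {P : Subset n → Set} (P? : Decidable P) (v : Fin n) {E : List (Subset n)} → Unique E →
  (∀ {e f} → e ∈ˡ E → f ∈ˡ E → P e → P f → v ∈ e → v ∈ f → e ≡ f) → deg v (filter P? E) ≤ 1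
deg-filter≤1 P? v unique eq =
  length≤1 (Uniqueₚ.filter⁺ (v ∈?_) (Uniqueₚ.filter⁺ P? unique)) λ e∈ f∈ →
    let e∈F , v∈e = ∈-filter⁻ (v ∈?_) e∈
        f∈F , v∈f = ∈-filter⁻ (v ∈?_) f∈
        e∈E , Pe = ∈-filter⁻ P? e∈F
        f∈E , Pf = ∈-filter⁻ P? f∈F
    in eq e∈E f∈E Pe Pf v∈e v∈f

-- Three-element subsets

-- An edge with its vertices named in a chosen order, so that lemmas can give each vertex a role;
-- `swap₁₂` and `swap₂₃` generate all reorderings.
record Tri (e : Subset n) (x y z : Fin n) : Set where
  constructor tri
  field
    ∈₁   : x ∈ e
    ∈₂   : y ∈ e
    ∈₃   : z ∈ e
    1≢2  : x ≢ y
    1≢3  : x ≢ z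
    2≢3  : y ≢ z
    only : ∀ {v} → v ∈ e → v ≡ x ⊎ v ≡ y ⊎ v ≡ z
open Tri

swap₁₂ : {e : Subset n} {x y z : Fin n} → Tri e x y z → Tri e y x z
swap₁₂ (tri a b c xy xz yz o) =
  tri b a c (≢-sym xy) yz xz (Sum.assocʳ ∘ Sum.map₁ Sum.swap ∘ Sum.assocˡ ∘ o)

swap₂₃ : {e : Subset n} {x y z : Fin n} → Tri e x y z → Tri e x z y
swap₂₃ (tri a b c xy xz yz o) = tri a c b xz xy (≢-sym yz) (Sum.map₂ Sum.swap ∘ o)

∈∉⇒≢ : {e : Subset n} {x y : Fin n} → x ∈ e → y ∉ e → x ≢ y
∈∉⇒≢ x∈e y∉e refl = y∉e x∈e

∉-tri : {e : Subset n} {x y z v : Fin n} → Tri e x y z → v ≢ x → v ≢ y → v ≢ z → v ∉ e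
∉-tri t v≢x v≢y v≢z v∈e with only t v∈e
... | inj₁ p = v≢x p
... | inj₂ (inj₁ p) = v≢y p
... | inj₂ (inj₂ p) = v≢z p

disjoint : {e f : Subset n} {x y z : Fin n} → Tri f x y z → x ∉ e → y ∉ e → z ∉ e →
  ∀ {v} → v ∈ e → v ∉ f
disjoint t x∉e y∉e z∉e v∈e = ∉-tri t (∈∉⇒≢ v∈e x∉e) (∈∉⇒≢ v∈e y∉e) (∈∉⇒≢ v∈e z∉e)

∣p∣≡0⇒∉ : (p : Subset n) {x : Fin n} → ∣ p ∣ ≡ 0 → x ∉ p
∣p∣≡0⇒∉ p {x} eq x∈p = contradiction (≤-trans (≤-reflexive (sym (∣⁅x⁆∣≡1 x)))
  (p⊆q⇒∣p∣≤∣q∣ {p = ⁅ x ⁆} {q = p} (λ v∈ → subst (_∈ p) (sym (x∈⁅y⁆⇒x≡y x v∈)) x∈p)))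
  (≤⇒≯ (≤-reflexive eq))

-- Peeling off one element at a time is how `triple₁` turns the cardinality 3 into three named
-- vertices.
remove : (p : Subset n) {x : Fin n} → x ∈ p → ∣ p ∣ ≡ suc k →
  ∃[ q ] (∣ q ∣ ≡ k × x ∉ q × (∀ {v} → v ∈ q → v ∈ p) × (∀ {v} → v ∈ p → v ≡ x ⊎ v ∈ q))
remove (inside ∷ p) here eq = outside ∷ p , suc-injective eq , (λ ()) , (λ { (there i) → there i }) ,
  λ { here → inj₁ refl ; (there i) → inj₂ (there i) }
remove (outside ∷ p) (there x∈p) eq with remove p x∈p eq
... | q , eq′ , x∉q , q⊆p , p⊆ = outside ∷ q , eq′ , (λ { (there i) → x∉q i }) ,
  (λ { (there i) → there (q⊆p i) }) ,
  λ { (there i) → Sum.map (cong suc) there (p⊆ i) }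
remove {k = zero} (inside ∷ p) (there x∈p) eq =
  contradiction x∈p (∣p∣≡0⇒∉ p (suc-injective eq))
remove {k = suc k} (inside ∷ p) (there x∈p) eq with remove p x∈p (suc-injective eq)
... | q , eq′ , x∉q , q⊆p , p⊆ = inside ∷ q , cong suc eq′ , (λ { (there i) → x∉q i }) ,
  (λ { here → here ; (there i) → there (q⊆p i) }) ,
  λ { here → inj₂ here ; (there i) → Sum.map (cong suc) there (p⊆ i) }

element : (p : Subset n) → ∣ p ∣ ≡ suc k → Nonempty p
element {n} p eq with nonempty? p
... | yes x = x
... | no ¬x = contradiction (trans (sym eq) (trans (cong ∣_∣ (Empty-unique ¬x)) (∣⊥∣≡0 n))) λ ()

abstract
  triple₁ : (e : Subset n) {x : Fin n} → ∣ e ∣ ≡ 3 → x ∈ e → ∃[ y ] ∃[ z ] Tri e x y z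
  triple₁ e {x} eq x∈e with remove e x∈e eq
  ... | p , p≡2 , x∉p , p⊆e , e⊆p with element p p≡2
  ...   | y , y∈p with remove p y∈p p≡2
  ...     | q , q≡1 , y∉q , q⊆p , p⊆q with element q q≡1
  ...       | z , z∈q with remove q z∈q q≡1
  ...         | r , r≡0 , z∉r , _ , q⊆r =
    y , z , tri x∈e (p⊆e y∈p) (p⊆e (q⊆p z∈q)) (≢-sym (∈∉⇒≢ y∈p x∉p)) (≢-sym (∈∉⇒≢ (q⊆p z∈q) x∉p))
      (≢-sym (∈∉⇒≢ z∈q y∉q)) λ v∈e → members (e⊆p v∈e)
    where
    members : ∀ {v} → v ≡ x ⊎ v ∈ p → v ≡ x ⊎ v ≡ y ⊎ v ≡ z
    members (inj₁ v≡x) = inj₁ v≡x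
    members (inj₂ v∈p) with p⊆q v∈p
    ... | inj₁ v≡y = inj₂ (inj₁ v≡y)
    ... | inj₂ v∈q with q⊆r v∈q
    ...   | inj₁ v≡z = inj₂ (inj₂ v≡z)
    ...   | inj₂ v∈r = contradiction v∈r (∣p∣≡0⇒∉ r r≡0)

  triple₂ : (e : Subset n) {x y : Fin n} → ∣ e ∣ ≡ 3 → x ∈ e → y ∈ e → x ≢ y → ∃[ z ] Tri e x y z
  triple₂ e eq x∈e y∈e x≢y with triple₁ e eq x∈e
  ... | p , q , t with only t y∈e
  ...   | inj₁ refl = contradiction refl x≢y
  ...   | inj₂ (inj₁ refl) = q , t
  ...   | inj₂ (inj₂ refl) = p , swap₂₃ t

  triple₃ : (e : Subset n) {x y z : Fin n} → ∣ e ∣ ≡ 3 → x ∈ e → y ∈ e → z ∈ e →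
    x ≢ y → x ≢ z → y ≢ z → Tri e x y z
  triple₃ e eq x∈e y∈e z∈e x≢y x≢z y≢z with triple₂ e eq x∈e y∈e x≢y
  ... | w , t with only t z∈e
  ...   | inj₁ refl = contradiction refl x≢z
  ...   | inj₂ (inj₁ refl) = contradiction refl y≢z
  ...   | inj₂ (inj₂ refl) = t

tri-⊆ : {e f : Subset n} {x y z : Fin n} → Tri e x y z → Tri f x y z → ∀ {v} → v ∈ e → v ∈ f
tri-⊆ s t v∈e with only s v∈e
... | inj₁ refl = ∈₁ t
... | inj₂ (inj₁ refl) = ∈₂ t
... | inj₂ (inj₂ refl) = ∈₃ t

tri-unique : {e f : Subset n} {x y z : Fin n} → Tri e x y z → Tri f x y z → e ≡ f
tri-unique s t = ⊆-antisym (tri-⊆ s t) (tri-⊆ t s)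

∣p∣≡1 : {p : Subset n} {x : Fin n} → x ∈ p → (∀ {v} → v ∈ p → v ≡ x) → ∣ p ∣ ≡ 1
∣p∣≡1 {p = p} {x} x∈p only-x = trans (cong ∣_∣ (⊆-antisym
  (λ v∈p → subst (_∈ ⁅ x ⁆) (sym (only-x v∈p)) (x∈⁅x⁆ x))
  (λ v∈x → subst (_∈ p) (sym (x∈⁅y⁆⇒x≡y x v∈x)) x∈p))) (∣⁅x⁆∣≡1 x)

∣p∣≡0 : {p : Subset n} → (∀ {v} → v ∉ p) → ∣ p ∣ ≡ 0
∣p∣≡0 {n} v∉p = trans (cong ∣_∣ (Empty-unique (λ (_ , v∈p) → v∉p v∈p))) (∣⊥∣≡0 n)

-- Families violating the degree bound

touches? : {P : Fin n → Set} → Decidable P → Decidable (λ e → ∃[ v ] (v ∈ e × P v))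
touches? P? e = anyFin? (λ v → (v ∈? e) ×-dec P? v)

-- The hypotheses on a counterexample in a form that survives deleting vertices: `W` shrinks while
-- `n` remains the original order. `deg-small` negates the desired degree bound.
record Family (E : List (Subset n)) (W : List (Fin n)) : Set where
  field
    uniform₃   : ∀ {e} → e ∈ˡ E → ∣ e ∣ ≡ 3
    unique     : Unique E
    path-free  : ∀ {e f g} → e ∈ˡ E → f ∈ˡ E → g ∈ˡ E →
                 ∣ e ∩ f ∣ ≡ 1 → ∣ f ∩ g ∣ ≡ 1 → ∣ e ∩ g ∣ ≢ 0
    in-W       : ∀ {e v} → e ∈ˡ E → v ∈ e → v ∈ˡ W
    deg-small  : ∀ v → 32 * deg v E + 32 * n < n * n

module Dense {E : List (Subset n)} {W : List (Fin n)} (family : Family E W)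
  (dense : ∀ {P : Fin n → Set} (P? : Decidable P) → ∃[ v ] (v ∈ˡ W × P v) →
           length (filter P? W) * n < 8 * length (filter (touches? P?) E))
  (large : 1000 ≤ n) where

  open Family family

  -- Path-freeness in terms of membership, with `f` as the middle edge, `x` and `z` its joints and
  -- `y` its private vertex. Later proofs only have to check which vertices lie where.
  no-path : ∀ {e f g x y z} → e ∈ˡ E → f ∈ˡ E → g ∈ˡ E → Tri f x y z →
    x ∈ e → y ∉ e → z ∉ e → z ∈ g → x ∉ g → y ∉ g → (∀ {v} → v ∈ e → v ∉ g) → False
  no-path {e} {f} {g} {x} {y} {z} e∈E f∈E g∈E t x∈e y∉e z∉e z∈g x∉g y∉g e∩g=∅ =
    path-free e∈E f∈E g∈E
      (∣p∣≡1 (x∈p∩q⁺ (x∈e , ∈₁ t)) (λ v∈ → at-x (x∈p∩q⁻ e f v∈)))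
      (∣p∣≡1 (x∈p∩q⁺ (∈₃ t , z∈g)) (λ v∈ → at-z (x∈p∩q⁻ f g v∈)))
      (∣p∣≡0 (λ v∈ → let v∈e , v∈g = x∈p∩q⁻ e g v∈ in e∩g=∅ v∈e v∈g))
    where
    at-x : ∀ {v} → v ∈ e × v ∈ f → v ≡ x
    at-x (v∈e , v∈f) with only t v∈f
    ... | inj₁ v≡x = v≡x
    ... | inj₂ (inj₁ refl) = contradiction v∈e y∉e
    ... | inj₂ (inj₂ refl) = contradiction v∈e z∉e
    at-z : ∀ {v} → v ∈ f × v ∈ g → v ≡ z
    at-z (v∈f , v∈g) with only t v∈f
    ... | inj₁ refl = contradiction v∈g x∉g
    ... | inj₂ (inj₁ refl) = contradiction v∈g y∉g
    ... | inj₂ (inj₂ v≡z) = v≡z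

  same-edge : ∀ {e f x y z} → e ∈ˡ E → f ∈ˡ E → x ≢ y → x ≢ z → y ≢ z →
    x ∈ e → y ∈ e → z ∈ e → x ∈ f → y ∈ f → z ∈ f → e ≡ f
  same-edge e∈E f∈E x≢y x≢z y≢z x∈e y∈e z∈e x∈f y∈f z∈f = tri-unique
    (triple₃ _ (uniform₃ e∈E) x∈e y∈e z∈e x≢y x≢z y≢z)
    (triple₃ _ (uniform₃ f∈E) x∈f y∈f z∈f x≢y x≢z y≢z)

  -- Apply `dense` to the single vertex `x`: its degree exceeds n / 8, and 1000 is larger than 8 *
  -- 90. The value 90 = 9 * 10 is the number of edges at `x` that nine vertices not thick with `x`
  -- can block in `avoid-thin`.
  deg>90 : ∀ {e x} → e ∈ˡ E → x ∈ e → 90 < deg x E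
  deg>90 {e} {x} e∈E x∈e = ≰⇒> λ deg≤90 → <⇒≱ (begin-strict
    n                                               ≡⟨ *-identityˡ n ⟨
    1 * n                                           ≤⟨ *-monoˡ-≤ n (filter-some (_≟ x) (lose x∈W refl)) ⟩
    length (filter (_≟ x) W) * n                    <⟨ dense (_≟ x) (x , x∈W , refl) ⟩
    8 * length (filter (touches? (_≟ x)) E)         ≤⟨ *-monoʳ-≤ 8 (length-filter-mono _ (x ∈?_) E (λ { _ (_ , x∈ , refl) → x∈ })) ⟩
    8 * deg x E                                     ≤⟨ *-monoʳ-≤ 8 deg≤90 ⟩
    720                                             ∎) (≤-trans (m≤m+n 720 280) large)
    where
    open ≤-Reasoning
    x∈W = in-W e∈E x∈e

  -- Thick pairs and edges that dodge given vertices

  codeg : Fin n → Fin n → ℕ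
  codeg x y = deg y (filter (x ∈?_) E)

  -- The threshold lets an edge through a thick pair dodge ten further vertices.
  record Thick (x y : Fin n) : Set where
    constructor thick
    field many : 11 ≤ codeg x y

  thick? : ∀ x y → Dec (Thick x y)
  thick? x y = map′ thick Thick.many (11 ≤? codeg x y)

  thick-sym : ∀ {x y} → Thick x y → Thick y x
  thick-sym {x} {y} (thick many) = thick (≤-trans many (begin
    codeg x y                                                      ≡⟨ cong length (filter-filter (x ∈?_) (y ∈?_) E) ⟩
    length (filter (λ e → (x ∈? e) ×-dec (y ∈? e)) E)              ≤⟨ length-filter-mono _ _ E (λ _ → swap) ⟩
    length (filter (λ e → (y ∈? e) ×-dec (x ∈? e)) E)              ≡⟨ cong length (filter-filter (y ∈?_) (x ∈?_) E) ⟨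
    codeg y x                                                      ∎))
    where open ≤-Reasoning

  abstract
    -- A third vertex determines the edge through `x` and `y`, so ten vertices block at most ten of
    -- the at least eleven edges on the pair.
    avoid-thick : ∀ {x y} → Thick x y → x ≢ y → (V : List (Fin n)) → length V ≤ 10 →
      All (λ v → v ≢ x × v ≢ y) V → ∃[ z ] ∃[ e ] (e ∈ˡ E × Tri e x y z × All (_∉ e) V)
    avoid-thick {x} {y} (thick many) x≢y V V≤10 others =
      let e , e∈ , misses = avoid V (filter (y ∈?_) (filter (x ∈?_) E)) (All.map single others)
            (≤-trans (s≤s (≤-trans (≤-reflexive (*-identityʳ _)) V≤10)) many)
          e∈Eˣ , y∈e = ∈-filter⁻ (y ∈?_) e∈
          e∈E , x∈e = ∈-filter⁻ (x ∈?_) e∈Eˣ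
          z , t = triple₂ e (uniform₃ e∈E) x∈e y∈e x≢y
      in z , e , e∈E , t , misses
      where
      single : ∀ {v} → v ≢ x × v ≢ y → deg v (filter (y ∈?_) (filter (x ∈?_) E)) ≤ 1
      single {v} (v≢x , v≢y) = subst (λ F → deg v F ≤ 1) (sym (filter-filter (x ∈?_) (y ∈?_) E))
        (deg-filter≤1 _ v unique λ { e∈E f∈E (x∈e , y∈e) (x∈f , y∈f) v∈e v∈f →
          same-edge e∈E f∈E x≢y (≢-sym v≢x) (≢-sym v≢y) x∈e y∈e v∈e x∈f y∈f v∈f })

    -- Each vertex of `V` shares at most ten edges with `x`, so nine of them block at most 90, fewer
    -- than the degree of `x`.
    avoid-thin : ∀ {e x} → e ∈ˡ E → x ∈ e → (V : List (Fin n)) → length V ≤ 9 →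
      All (λ v → ¬ Thick x v) V → ∃[ f ] (f ∈ˡ E × x ∈ f × All (_∉ f) V)
    avoid-thin {x = x} e∈E x∈e V V≤9 thin =
      let f , f∈ , misses = avoid V (filter (x ∈?_) E) {10} (All.map (λ ¬t → ≤-pred (≰⇒> (¬t ∘ thick))) thin)
            (≤-<-trans (*-monoˡ-≤ 10 V≤9) (deg>90 e∈E x∈e))
          f∈E , x∈f = ∈-filter⁻ (x ∈?_) f∈
      in f , f∈E , x∈f , misses

  -- Otherwise an edge `g` on the thick pair `x`, `a` can be chosen to miss `z` and all of `f`. Then
  -- `g`, `e`, `f` is a path with joints `x` and `y`.
  forced : ∀ {e f x y z a} → e ∈ˡ E → Tri e x y z → Thick x a → a ∉ e →
    f ∈ˡ E → y ∈ f → x ∉ f → z ∉ f → a ∈ f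
  forced {e} {f} {x} {y} {z} {a} e∈E t xa a∉e f∈E y∈f x∉f z∉f with a ∈? f
  ... | yes a∈f = a∈f
  ... | no a∉f with triple₁ f (uniform₃ f∈E) y∈f
  ...   | p , q , s with avoid-thick xa (∈∉⇒≢ (∈₁ t) a∉e) (y ∷ p ∷ q ∷ z ∷ []) (m≤m+n 4 6)
            ( (∈∉⇒≢ y∈f x∉f , ∈∉⇒≢ y∈f a∉f) ∷ (∈∉⇒≢ (∈₂ s) x∉f , ∈∉⇒≢ (∈₂ s) a∉f)
            ∷ (∈∉⇒≢ (∈₃ s) x∉f , ∈∉⇒≢ (∈₃ s) a∉f) ∷ (≢-sym (1≢3 t) , ∈∉⇒≢ (∈₃ t) a∉e) ∷ [])
  ...     | _ , g , g∈E , r , y∉g ∷ p∉g ∷ q∉g ∷ z∉g ∷ [] =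
    ⊥-elim (no-path g∈E e∈E f∈E (swap₂₃ t) (∈₁ r) z∉g y∉g y∈f x∉f z∉f (disjoint s y∉g p∉g q∉g))

  -- If `c` were outside `f`, an edge on `a`, `b` avoiding `c` and the rest of `f` would meet `f`
  -- only at `a`, and `forced` along the thick pair `b`, `c` puts `c` into `f` after all.
  thick-path : ∀ {a b c f} → Thick a b → Thick b c → a ≢ b → b ≢ c → a ≢ c →
    f ∈ˡ E → a ∈ f → b ∉ f → c ∈ f
  thick-path {a} {b} {c} {f} ab bc a≢b b≢c a≢c f∈E a∈f b∉f with c ∈? f
  ... | yes c∈f = c∈f
  ... | no c∉f with triple₁ f (uniform₃ f∈E) a∈f
  ...   | p , q , s with avoid-thick ab a≢b (c ∷ p ∷ q ∷ []) (m≤m+n 3 7)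
            ( (≢-sym a≢c , ≢-sym b≢c) ∷ (≢-sym (1≢2 s) , ∈∉⇒≢ (∈₂ s) b∉f)
            ∷ (≢-sym (1≢3 s) , ∈∉⇒≢ (∈₃ s) b∉f) ∷ [])
  ...     | w , e , e∈E , t , c∉e ∷ p∉e ∷ q∉e ∷ [] =
    forced e∈E (swap₁₂ t) bc c∉e f∈E a∈f b∉f
      (∉-tri s (≢-sym (1≢3 t)) (∈∉⇒≢ (∈₃ t) p∉e) (∈∉⇒≢ (∈₃ t) q∉e))

  -- Any other `w` would give an edge on the thick pair `a`, `w` that avoids both `b` and `c`, which
  -- `thick-path` forbids.
  thick-end : ∀ {a b c w} → Thick a b → Thick b c → Thick a w → a ≢ b → b ≢ c → a ≢ c →
    w ≢ a → w ≢ b → w ≡ c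
  thick-end {a} {b} {c} {w} ab bc aw a≢b b≢c a≢c w≢a w≢b with w ≟ c
  ... | yes w≡c = w≡c
  ... | no w≢c with avoid-thick aw (≢-sym w≢a) (b ∷ c ∷ []) (m≤m+n 2 8)
          ((≢-sym a≢b , ≢-sym w≢b) ∷ (≢-sym a≢c , ≢-sym w≢c) ∷ [])
  ...   | _ , f , f∈E , t , b∉f ∷ c∉f ∷ [] =
    contradiction (thick-path ab bc a≢b b≢c a≢c f∈E (∈₁ t) b∉f) c∉f

  -- The star around a vertex with two thick partners

  module Star {b : Fin n} where

    -- The centre is excluded explicitly because `codeg b b` is the degree of `b`, so `Thick b b`
    -- may hold. The same reason explains the inequality in `Paired`.
    Leaf : Fin n → Set
    Leaf v = Thick b v × v ≢ b

    leaf? : Decidable Leaf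
    leaf? v = thick? b v ×-dec ¬? (v ≟ b)

    -- Suppose `w` is neither `d` nor thick with `b`. By `thick-end` on the thick path through `c`,
    -- `b`, `d`, it is not thick with `c` or `d` either. Hence some edge at `w` avoids `b`, `c` and
    -- `d`, while `forced` would place `d` in it.
    leaf-grow : ∀ {c d e w} → Leaf c → Leaf d → c ≢ d → e ∈ˡ E → Tri e b c w → Leaf w
    leaf-grow {c} {d} {e} {w} (bc , c≢b) (bd , d≢b) c≢d e∈E t with w ≟ d | thick? b w
    ... | yes refl | _ = bd , d≢b
    ... | no _ | yes bw = bw , ≢-sym (1≢3 t)
    ... | no w≢d | no ¬bw with avoid-thin e∈E (∈₃ t) (b ∷ c ∷ d ∷ []) (m≤m+n 3 6)
            ( (λ wb → ¬bw (thick-sym wb))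
            ∷ (λ wc → w≢d (thick-end (thick-sym bc) bd (thick-sym wc) c≢b (≢-sym d≢b) c≢d
                             (≢-sym (2≢3 t)) (≢-sym (1≢3 t))))
            ∷ (λ wd → 2≢3 t (sym (thick-end (thick-sym bd) bc (thick-sym wd) d≢b (≢-sym c≢b)
                             (≢-sym c≢d) w≢d (≢-sym (1≢3 t))))) ∷ [])
    ...   | f , f∈E , w∈f , b∉f ∷ c∉f ∷ d∉f ∷ [] =
      contradiction (forced e∈E (swap₂₃ t) bd (∉-tri t d≢b (≢-sym c≢d) (≢-sym w≢d)) f∈E w∈f b∉f c∉f) d∉f

    -- If `f` missed `b`, `thick-path` through `b` would put every leaf into `f`. Two applications
    -- of `leaf-grow` produce further leaves `u` and `w`, and the four vertices `c`, `d`, `u`, `w`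
    -- do not fit into one edge.
    centre∈ : ∀ {c d f} → Leaf c → Leaf d → c ≢ d → f ∈ˡ E → c ∈ f → b ∈ f
    centre∈ {c} {d} {f} lc@(bc , c≢b) ld@(bd , d≢b) c≢d f∈E c∈f with b ∈? f
    ... | yes b∈f = b∈f
    ... | no b∉f with avoid-thick bc (≢-sym c≢b) (d ∷ []) (m≤m+n 1 9) ((d≢b , ≢-sym c≢d) ∷ [])
    ...   | u , e , e∈E , t , d∉e ∷ [] with avoid-thick bc (≢-sym c≢b) (d ∷ u ∷ []) (m≤m+n 2 8)
              ((d≢b , ≢-sym c≢d) ∷ (≢-sym (1≢3 t) , ≢-sym (2≢3 t)) ∷ [])
    ...     | w , g , g∈E , s , d∉g ∷ u∉g ∷ [] =
      contradiction (leaf∈ (2≢3 s) (leaf-grow lc ld c≢d g∈E s))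
        (∉-tri (triple₃ f (uniform₃ f∈E) c∈f (leaf∈ c≢d ld) (leaf∈ (2≢3 t) (leaf-grow lc ld c≢d e∈E t))
                  c≢d (2≢3 t) (≢-sym (∈∉⇒≢ (∈₃ t) d∉e)))
          (≢-sym (2≢3 s)) (∈∉⇒≢ (∈₃ s) d∉g) (∈∉⇒≢ (∈₃ s) u∉g))
      where
      leaf∈ : ∀ {v} → c ≢ v → Leaf v → v ∈ f
      leaf∈ c≢v (bv , v≢b) = thick-path (thick-sym bc) bv c≢b (≢-sym v≢b) c≢v f∈E c∈f b∉f

    module _ {c₁ c₂ : Fin n} (l₁ : Leaf c₁) (l₂ : Leaf c₂) (c₁≢c₂ : c₁ ≢ c₂) where

      other-leaf : ∀ c → ∃[ d ] (Leaf d × c ≢ d)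
      other-leaf c with c ≟ c₁
      ... | yes refl = c₂ , l₂ , c₁≢c₂
      ... | no c≢c₁ = c₁ , l₁ , c≢c₁

      leaf-edge : ∀ {c f} → Leaf c → f ∈ˡ E → c ∈ f → b ∈ f × ∃[ w ] (w ∈ f × Leaf w × c ≢ w)
      leaf-edge {c} {f} lc f∈E c∈f =
        let d , ld , c≢d = other-leaf c
            b∈f = centre∈ lc ld c≢d f∈E c∈f
            w , t = triple₂ f (uniform₃ f∈E) b∈f c∈f (≢-sym (proj₂ lc))
        in b∈f , w , ∈₃ t , leaf-grow lc ld c≢d f∈E t , 2≢3 t

      S = filter leaf? W
      F = filter (touches? leaf?) E

      ∈S : ∀ {v f} → f ∈ˡ E → v ∈ f → Leaf v → v ∈ˡ S
      ∈S f∈E v∈f = ∈-filter⁺ leaf? (in-W f∈E v∈f)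

      -- Every edge at the leaf `c` consists of `b`, `c` and another leaf, and that other leaf
      -- determines it.
      leaf-deg : ∀ {c} → c ∈ˡ S → deg c F ≤ length S
      leaf-deg {c} c∈S = begin
        deg c F                                 ≡⟨ cong length (filter-filter (touches? leaf?) (c ∈?_) E) ⟩
        length Fᶜ                               ≡⟨ *-identityʳ _ ⟨
        length Fᶜ * 1                           ≤⟨ double-count S\c Fᶜ meets single ⟩
        length S\c * 1                          ≡⟨ *-identityʳ _ ⟩
        length S\c                              ≤⟨ length-filter _ S ⟩
        length S                                ∎
        where
        open ≤-Reasoning
        lc = proj₂ (∈-filter⁻ leaf? {xs = W} c∈S)
        S\c = filter (λ v → ¬? (c ≟ v)) S
        c? = λ f → touches? leaf? f ×-dec (c ∈? f)
        Fᶜ = filter c? E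
        meets : ∀ {f} → f ∈ˡ Fᶜ → 1 ≤ hits S\c f
        meets f∈ =
          let f∈E , _ , c∈f = ∈-filter⁻ c? f∈
              _ , w , w∈f , lw , c≢w = leaf-edge lc f∈E c∈f
          in 1≤hits (∈-filter⁺ (λ v → ¬? (c ≟ v)) (∈S f∈E w∈f lw) c≢w) w∈f
        single : ∀ {v} → v ∈ˡ S\c → deg v Fᶜ ≤ 1
        single {v} v∈ =
          let v∈S , c≢v = ∈-filter⁻ (λ v → ¬? (c ≟ v)) v∈
              lv = proj₂ (∈-filter⁻ leaf? {xs = W} v∈S)
          in deg-filter≤1 c? v unique λ { e∈E f∈E (_ , c∈e) (_ , c∈f) v∈e v∈f →
               same-edge e∈E f∈E (≢-sym (proj₂ lc)) (≢-sym (proj₂ lv)) c≢v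
                 (proj₁ (leaf-edge lc e∈E c∈e)) c∈e v∈e (proj₁ (leaf-edge lc f∈E c∈f)) c∈f v∈f }

      -- Each edge of `F` contains two leaves, so 2|F| ≤ |S|² by `leaf-deg`. With |S|n < 8|F| from
      -- `dense` this gives n < 4|S|. Then n² ≤ 4|S|n < 32|F|, and all edges of `F` pass through
      -- `b`, against `deg-small`.
      no-star : False
      -- An edge on `b` and `c₁` certifies that `c₁` lies in `W`, so that `dense` applies to a
      -- nonempty set of leaves.
      no-star with avoid-thick (proj₁ l₁) (≢-sym (proj₂ l₁)) [] z≤n []
      ... | _ , e , e∈E , t , _ = <-asym n²<32deg (≤-<-trans (m≤m+n _ _) (deg-small b))
        where
        open ≤-Reasoning
        meets : ∀ {f} → f ∈ˡ F → 2 ≤ hits S f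
        meets f∈F =
          let f∈E , c , c∈f , lc = ∈-filter⁻ (touches? leaf?) f∈F
              _ , w , w∈f , lw , c≢w = leaf-edge lc f∈E c∈f
          in 2≤hits (∈S f∈E c∈f lc) c∈f (∈S f∈E w∈f lw) w∈f c≢w
        2F≤S² : length F * 2 ≤ length S * length S
        2F≤S² = double-count S F meets leaf-deg
        F≤deg : length F ≤ deg b E
        F≤deg = length-filter-mono (touches? leaf?) (b ∈?_) E
          λ { f∈E (c , c∈f , lc) → proj₁ (leaf-edge lc f∈E c∈f) }
        Sn<8F : length S * n < 8 * length F
        Sn<8F = dense leaf? (c₁ , in-W e∈E (∈₂ t) , l₁)
        n<4S : n < 4 * length S
        n<4S = *-cancelˡ-< (length S) n (4 * length S) (begin-strict
          length S * n               <⟨ Sn<8F ⟩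
          8 * length F               ≡⟨ solve 1 (λ f → con 8 :* f := con 4 :* (f :* con 2)) refl (length F) ⟩
          4 * (length F * 2)         ≤⟨ *-monoʳ-≤ 4 2F≤S² ⟩
          4 * (length S * length S)  ≡⟨ solve 1 (λ s → con 4 :* (s :* s) := s :* (con 4 :* s)) refl (length S) ⟩
          length S * (4 * length S)  ∎)
          where open +-*-Solver
        n²<32deg : n * n < 32 * deg b E
        n²<32deg = begin-strict
          n * n                      ≤⟨ *-monoˡ-≤ n (<⇒≤ n<4S) ⟩
          4 * length S * n           ≡⟨ *-assoc 4 (length S) n ⟩
          4 * (length S * n)         <⟨ *-monoʳ-< 4 Sn<8F ⟩
          4 * (8 * length F)         ≡⟨ *-assoc 4 8 (length F) ⟨
          32 * length F              ≤⟨ *-monoʳ-≤ 32 F≤deg ⟩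
          32 * deg b E               ∎

  -- Thick pairs as a matching

  thick-matching : ∀ {b c d} → Thick b c → Thick b d → c ≢ b → d ≢ b → c ≡ d
  thick-matching {b} {c} {d} bc bd c≢b d≢b with c ≟ d
  ... | yes c≡d = c≡d
  ... | no c≢d = ⊥-elim (Star.no-star (bc , c≢b) (bd , d≢b) c≢d)

  Paired : Fin n → Set
  Paired v = ∃[ u ] (u ≢ v × Thick v u)

  paired? : Decidable Paired
  paired? v = anyFin? (λ u → ¬? (u ≟ v) ×-dec thick? v u)

  -- A partner `w′` of `w` would start a path: from `e` through `w` to an edge `f` on `w`, `w′`
  -- avoiding `a` and `b`, then through the third vertex `u` of `f` to an edge avoiding everything
  -- else.
  third-unpaired : ∀ {e a b w} → e ∈ˡ E → Tri e a b w → Thick a b → ¬ Paired w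
  third-unpaired {e} {a} {b} {w} e∈E t ab (w′ , w′≢w , ww′)
    with avoid-thick ww′ (≢-sym w′≢w) (a ∷ b ∷ []) (m≤m+n 2 8)
           ((1≢3 t , ≢-sym w′≢a) ∷ (2≢3 t , ≢-sym w′≢b) ∷ [])
    where
    -- `a` and `b` are already partners of each other, so neither can also be thick with `w`.
    w′≢a : w′ ≢ a
    w′≢a refl = 2≢3 t (thick-matching ab (thick-sym ww′) (≢-sym (1≢2 t)) (≢-sym (1≢3 t)))
    w′≢b : w′ ≢ b
    w′≢b refl = 1≢3 t (thick-matching (thick-sym ab) (thick-sym ww′) (1≢2 t) (≢-sym (2≢3 t)))
  ... | u , f , f∈E , s , a∉f ∷ b∉f ∷ []
    -- `u` is thick with none of these four vertices, since each of them already has a partner other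
    -- than `u`.
    with avoid-thin f∈E (∈₃ s) (a ∷ b ∷ w ∷ w′ ∷ []) (m≤m+n 4 5)
           ( (λ ua → ∈∉⇒≢ (∈₃ s) b∉f (thick-matching (thick-sym ua) ab u≢a (≢-sym (1≢2 t))))
           ∷ (λ ub → u≢a (thick-matching (thick-sym ub) (thick-sym ab) u≢b (1≢2 t)))
           ∷ (λ uw → 2≢3 s (thick-matching ww′ (thick-sym uw) w′≢w (≢-sym (1≢3 s))))
           ∷ (λ uw′ → 1≢3 s (thick-matching (thick-sym ww′) (thick-sym uw′) (≢-sym w′≢w) (≢-sym (2≢3 s)))) ∷ [])
    where
    u≢a = ∈∉⇒≢ (∈₃ s) a∉f
    u≢b = ∈∉⇒≢ (∈₃ s) b∉f
  ... | g , g∈E , u∈g , a∉g ∷ b∉g ∷ w∉g ∷ w′∉g ∷ [] =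
    no-path e∈E f∈E g∈E s (∈₃ t)
      (∉-tri t (∈∉⇒≢ (∈₂ s) a∉f) (∈∉⇒≢ (∈₂ s) b∉f) w′≢w)
      (∉-tri t (∈∉⇒≢ (∈₃ s) a∉f) (∈∉⇒≢ (∈₃ s) b∉f) (≢-sym (1≢3 s)))
      u∈g w∉g w′∉g
      (λ v∈e v∈g → disjoint t a∉g b∉g w∉g v∈g v∈e)

  -- A partner `a` of `x` would lie outside `e` and could not be thick with `y` too. So some edge at
  -- `y` avoids `x`, `z` and `a`, contradicting `forced`.
  thin-unpaired : ∀ {e x y z} → e ∈ˡ E → Tri e x y z →
    ¬ Thick x y → ¬ Thick x z → ¬ Thick y z → ¬ Paired x
  thin-unpaired {e} {x} {y} {z} e∈E t ¬xy ¬xz ¬yz (a , a≢x , xa)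
    with avoid-thin e∈E (∈₂ t) (x ∷ z ∷ a ∷ []) (m≤m+n 3 6)
      ( (λ yx → ¬xy (thick-sym yx)) ∷ ¬yz
      ∷ (λ ya → 1≢2 t (thick-matching (thick-sym xa) (thick-sym ya) (≢-sym a≢x) y≢a)) ∷ [])
    where
    y≢a : y ≢ a
    y≢a refl = ¬xy xa
  ... | f , f∈E , y∈f , x∉f ∷ z∉f ∷ a∉f ∷ [] =
    a∉f (forced e∈E t xa (∉-tri t a≢x (λ { refl → ¬xy xa }) (λ { refl → ¬xz xa })) f∈E y∈f x∉f z∉f)

  -- Without a thick pair in `e`, the vertex `x` is unpaired, so an edge at `x` can dodge both the
  -- rest of `e` and an edge `f` leaving `e` at `y`. This is a path with `e` in the middle.
  some-thick : ∀ {e x y z} → e ∈ˡ E → Tri e x y z → ¬ Thick x y → ¬ Thick x z → ¬ Thick y z → False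
  some-thick {e} {x} {y} {z} e∈E t ¬xy ¬xz ¬yz
    with avoid-thin e∈E (∈₂ t) (x ∷ z ∷ []) (m≤m+n 2 7) ((λ yx → ¬xy (thick-sym yx)) ∷ ¬yz ∷ [])
  ... | f , f∈E , y∈f , x∉f ∷ z∉f ∷ [] with triple₁ f (uniform₃ f∈E) y∈f
  ...   | p , q , s with avoid-thin e∈E (∈₁ t) (y ∷ p ∷ q ∷ z ∷ []) (m≤m+n 4 5)
            ( ¬xy ∷ (λ xp → ¬paired (p , ∈∉⇒≢ (∈₂ s) x∉f , xp))
            ∷ (λ xq → ¬paired (q , ∈∉⇒≢ (∈₃ s) x∉f , xq)) ∷ ¬xz ∷ [])
    where
    ¬paired = thin-unpaired e∈E t ¬xy ¬xz ¬yz
  ...     | g , g∈E , x∈g , y∉g ∷ p∉g ∷ q∉g ∷ z∉g ∷ [] =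
    no-path g∈E e∈E f∈E (swap₂₃ t) x∈g z∉g y∉g y∈f x∉f z∉f (disjoint s y∉g p∉g q∉g)

  thick-pair : ∀ {e x} → e ∈ˡ E → x ∈ e → ∃[ a ] ∃[ b ] ∃[ w ] (Tri e a b w × Thick a b)
  thick-pair {e} {x} e∈E x∈e with triple₁ e (uniform₃ e∈E) x∈e
  ... | y , z , t with thick? x y | thick? x z | thick? y z
  ...   | yes xy | _ | _ = x , y , z , t , xy
  ...   | no _ | yes xz | _ = x , z , y , swap₂₃ t , xz
  ...   | no _ | no _ | yes yz = y , z , x , swap₂₃ (swap₁₂ t) , yz
  ...   | no ¬xy | no ¬xz | no ¬yz = ⊥-elim (some-thick e∈E t ¬xy ¬xz ¬yz)

  -- The edge contains a thick pair. Its third vertex is unpaired, so `v` belongs to that pair,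
  -- whose other member must be the unique partner of `v`.
  partner∈ : ∀ {e u v} → e ∈ˡ E → v ∈ e → u ≢ v → Thick v u → u ∈ e
  partner∈ e∈E v∈e u≢v vu with thick-pair e∈E v∈e
  ... | a , b , w , t , ab with only t v∈e
  ...   | inj₁ refl = subst (_∈ _) (thick-matching ab vu (≢-sym (1≢2 t)) u≢v) (∈₂ t)
  ...   | inj₂ (inj₁ refl) = subst (_∈ _) (thick-matching (thick-sym ab) vu (1≢2 t) u≢v) (∈₁ t)
  ...   | inj₂ (inj₂ refl) = contradiction (_ , u≢v , vu) (third-unpaired e∈E t ab)

  unpaired? : Decidable (λ v → ¬ Paired v)
  unpaired? v = ¬? (paired? v)

  I J : List (Fin n)
  I = filter unpaired? W
  J = filter paired? W

  -- Each edge at `w` uses two vertices of `J`, and no vertex of `J` occurs in two of these edges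
  -- because its partner always comes along.
  unpaired-deg : ∀ {w} → w ∈ˡ I → deg w E ≤ length J / 2
  unpaired-deg {w} w∈I = subst (_≤ length J / 2) (m*n/n≡m (deg w E) 2)
    (/-monoˡ-≤ 2 (subst (deg w E * 2 ≤_) (*-identityʳ (length J)) (double-count J (filter (w ∈?_) E) meets single)))
    where
    ¬pw = proj₂ (∈-filter⁻ unpaired? {xs = W} w∈I)
    meets : ∀ {e} → e ∈ˡ filter (w ∈?_) E → 2 ≤ hits J e
    meets e∈ with ∈-filter⁻ (w ∈?_) {xs = E} e∈
    ... | e∈E , w∈e with thick-pair e∈E w∈e
    ...   | a , b , _ , t , ab = 2≤hits
      (∈-filter⁺ paired? (in-W e∈E (∈₁ t)) (b , ≢-sym (1≢2 t) , ab)) (∈₁ t)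
      (∈-filter⁺ paired? (in-W e∈E (∈₂ t)) (a , 1≢2 t , thick-sym ab)) (∈₂ t) (1≢2 t)
    single : ∀ {v} → v ∈ˡ J → deg v (filter (w ∈?_) E) ≤ 1
    single {v} v∈J with proj₂ (∈-filter⁻ paired? {xs = W} v∈J)
    ... | pv@(u , u≢v , vu) = deg-filter≤1 (w ∈?_) v unique λ e∈E f∈E w∈e w∈f v∈e v∈f →
      same-edge e∈E f∈E (λ { refl → ¬pw pv }) (λ { refl → ¬pw (v , ≢-sym u≢v , thick-sym vu) }) (≢-sym u≢v)
        w∈e v∈e (partner∈ e∈E v∈e u≢v vu) w∈f v∈f (partner∈ f∈E v∈f u≢v vu)

  edges-≤ : length E ≤ length I * (length J / 2)
  edges-≤ = subst (_≤ length I * (length J / 2)) (*-identityʳ _) (double-count I E meets unpaired-deg)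
    where
    meets : ∀ {e} → e ∈ˡ E → 1 ≤ hits I e
    meets {e} e∈E with element e (uniform₃ e∈E)
    ... | x , x∈e with thick-pair e∈E x∈e
    ...   | a , b , w , t , ab =
      1≤hits (∈-filter⁺ unpaired? (in-W e∈E (∈₃ t)) (third-unpaired e∈E t ab)) (∈₃ t)

  8E≤W² : 8 * length E ≤ length W * length W
  8E≤W² = begin
    8 * length E                              ≤⟨ *-monoʳ-≤ 8 edges-≤ ⟩
    8 * (length I * (length J / 2))           ≡⟨ solve 2 (λ i h → con 8 :* (i :* h) := con 4 :* (i :* (h :* con 2))) refl (length I) (length J / 2) ⟩
    4 * (length I * (length J / 2 * 2))       ≤⟨ *-monoʳ-≤ 4 (*-monoʳ-≤ (length I) (m/n*n≤m (length J) 2)) ⟩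
    4 * (length I * length J)                 ≤⟨ am-gm (length I) (length J) ⟩
    (length J + length I) * (length J + length I) ≡⟨ cong₂ _*_ (length-filter-¬ paired? W) (length-filter-¬ paired? W) ⟩
    length W * length W                       ∎
    where
    open ≤-Reasoning
    open +-*-Solver
    -- Here `d` is the difference of the two numbers, and its square is the slack in the inequality.
    am-gm′ : ∀ i d → 4 * (i * (i + d)) ≤ ((i + d) + i) * ((i + d) + i)
    am-gm′ i d = ≤-trans (m≤m+n _ (d * d)) (≤-reflexive
      (solve 2 (λ i d → con 4 :* (i :* (i :+ d)) :+ d :* d := ((i :+ d) :+ i) :* ((i :+ d) :+ i)) refl i d))
    am-gm : ∀ i j → 4 * (i * j) ≤ (j + i) * (j + i)
    am-gm i j with ≤-total i j
    ... | inj₁ i≤j = subst (λ j → 4 * (i * j) ≤ (j + i) * (j + i)) (m+[n∸m]≡n i≤j) (am-gm′ i (j ∸ i))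
    ... | inj₂ j≤i = subst₂ _≤_ (cong (4 *_) (*-comm j i)) (cong₂ _*_ (+-comm i j) (+-comm i j))
      (subst (λ i → 4 * (j * i) ≤ (i + j) * (i + j)) (m+[n∸m]≡n j≤i) (am-gm′ j (i ∸ j)))

-- Induction on the vertex set

Family-filter : {E : List (Subset n)} {W : List (Fin n)} {P : Fin n → Set} (P? : Decidable P) → Family E W →
  Family (filter (λ e → ¬? (touches? P? e)) E) (filter (λ v → ¬? (P? v)) W)
Family-filter {E = E} P? family = record
  { uniform₃  = uniform₃ ∘ old
  ; unique    = Uniqueₚ.filter⁺ untouched? unique
  ; path-free = λ e∈ f∈ g∈ → path-free (old e∈) (old f∈) (old g∈)
  ; in-W      = λ {e} {v} e∈ v∈e → let e∈E , ¬touch = ∈-filter⁻ untouched? e∈ in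
                ∈-filter⁺ (λ v → ¬? (P? v)) (in-W e∈E v∈e) (λ Pv → ¬touch (v , v∈e , Pv))
  ; deg-small = λ v → ≤-<-trans (+-monoˡ-≤ _ (*-monoʳ-≤ 32 (deg-filter-≤ untouched? v E))) (deg-small v)
  }
  where
  open Family family
  untouched? = λ e → ¬? (touches? P? e)
  old : ∀ {e} → e ∈ˡ filter untouched? E → e ∈ˡ E
  old = proj₁ ∘ ∈-filter⁻ untouched?

-- Induction on a bound `k` for |W| replaces the choice of a minimal `W`. If the bound fails and
-- some nonempty `P` is touched by at most |P|n / 8 edges, delete `P`: the induction hypothesis for
-- the rest adds up to the bound for `W`. So `dense` holds, and `8E≤W²` with |W| ≤ n contradicts the
-- failure.
edges-bound : 1000 ≤ n → (k : ℕ) {E : List (Subset n)} {W : List (Fin n)} → length W ≤ k → length W ≤ n →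
  Family E W → 8 * length E ≤ length W * n
edges-bound {n} large k {E} {W} W≤k W≤n family = ≮⇒≥ λ Wn<8E →
  <⇒≱ Wn<8E (≤-trans (Dense.8E≤W² family (dense k W≤k Wn<8E) large) (*-monoʳ-≤ (length W) W≤n))
  where
  dense : ∀ k → length W ≤ k → length W * n < 8 * length E →
    ∀ {P : Fin n → Set} (P? : Decidable P) → ∃[ v ] (v ∈ˡ W × P v) →
    length (filter P? W) * n < 8 * length (filter (touches? P?) E)
  dense zero W≤0 _ P? (v , v∈W , _) = contradiction (n≤0⇒n≡0 W≤0) (λ eq → nonempty v∈W eq)
    where
    nonempty : ∀ {W : List (Fin n)} → v ∈ˡ W → length W ≢ 0
    nonempty (here _) ()
    nonempty (there _) ()
  dense (suc k) W≤k Wn<8E P? (v , v∈W , Pv) = ≰⇒> λ sparse → <⇒≱ Wn<8E (begin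
    8 * length E                              ≡⟨ cong (8 *_) (length-filter-¬ (touches? P?) E) ⟨
    8 * (length Eᴾ + length E′)               ≡⟨ *-distribˡ-+ 8 (length Eᴾ) (length E′) ⟩
    8 * length Eᴾ + 8 * length E′             ≤⟨ +-mono-≤ sparse (edges-bound large k (≤-pred (<-≤-trans W′<W W≤k))
                                                   (≤-trans (<⇒≤ W′<W) W≤n) (Family-filter P? family)) ⟩
    length Wᴾ * n + length W′ * n             ≡⟨ *-distribʳ-+ n (length Wᴾ) (length W′) ⟨
    (length Wᴾ + length W′) * n               ≡⟨ cong (_* n) (length-filter-¬ P? W) ⟩
    length W * n                              ∎)
    where
    open ≤-Reasoning
    Eᴾ = filter (touches? P?) E
    E′ = filter (λ e → ¬? (touches? P? e)) E
    Wᴾ = filter P? W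
    W′ = filter (λ v → ¬? (P? v)) W
    W′<W : length W′ < length W
    W′<W = filter-notAll (λ v → ¬? (P? v)) W (lose v∈W (λ ¬Pv → ¬Pv Pv))

-- Product lists, maxima and the degree bound

length-cartesianProductWith : {B C : Set} (f : A → B → C) (xs : List A) (ys : List B) →
  length (cartesianProductWith f xs ys) ≡ length xs * length ys
length-cartesianProductWith f [] ys = refl
length-cartesianProductWith f (x ∷ xs) ys = trans (length-++ (map (f x) ys))
  (cong₂ _+_ (length-map (f x) ys) (length-cartesianProductWith f xs ys))

foldr-⊔-≥ : (f : A → ℕ) {xs : List A} {x : A} → x ∈ˡ xs → f x ≤ foldr _⊔_ 0 (map f xs)
foldr-⊔-≥ f (here refl) = m≤m⊔n _ _
foldr-⊔-≥ f {y ∷ _} (there x∈) = ≤-trans (foldr-⊔-≥ f x∈) (m≤n⊔m (f y) _)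

foldr-⊔-≤ : (f : A → ℕ) (xs : List A) {d : ℕ} → (∀ x → f x ≤ d) → foldr _⊔_ 0 (map f xs) ≤ d
foldr-⊔-≤ f [] _ = z≤n
foldr-⊔-≤ f (x ∷ xs) f≤d = ⊔-lub (f≤d x) (foldr-⊔-≤ f xs f≤d)

-- If all degrees were small, `edges-bound` with `W` the whole vertex set would give 8m ≤ n² for the
-- number m of edges, contradicting `many`.
large-degree : (n : ℕ) → 1000 ≤ n → (H : ThreeGraph n) → P33Free H →
  n * n + 8 ≤ 8 * numEdges H → n * n ≤ 32 * maxDegree H + 32 * n
large-degree n large H free many = ≮⇒≥ λ small →
  <⇒≱ (<-≤-trans (m<m+n (n * n) (s≤s z≤n)) many)
    (subst (λ w → 8 * numEdges H ≤ w * n) (length-tabulate {n = n} (id {A = Fin n}))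
      (edges-bound large n {edges H} {W = allFin n} W≤n W≤n record
        { uniform₃  = All.lookup (uniform H)
        ; unique    = distinct H
        ; path-free = λ e∈ f∈ g∈ p q r → free (_ , _ , _ , e∈ , f∈ , g∈ , p , q , r)
        ; in-W      = λ _ _ → ∈-allFin _
        ; deg-small = λ v → ≤-<-trans (+-monoˡ-≤ _ (*-monoʳ-≤ 32 (foldr-⊔-≥ (degree H) (∈-allFin v)))) small
        }))
  where
  W≤n : length (allFin n) ≤ n
  W≤n = ≤-reflexive (length-tabulate {n = n} (id {A = Fin n}))

-- The extremal hypergraph

∣++∣ : ∀ {a b} (s : Subset a) (t : Subset b) → ∣ s ++ᵛ t ∣ ≡ ∣ s ∣ + ∣ t ∣
∣++∣ [] t = refl
∣++∣ (inside ∷ s) t = cong suc (∣++∣ s t)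
∣++∣ (outside ∷ s) t = ∣++∣ s t

∈-++ˡ : ∀ {a b} {s : Subset a} {t : Subset b} {v : Fin a} → v ∈ s → v ↑ˡ b ∈ s ++ᵛ t
∈-++ˡ here = here
∈-++ˡ (there v∈) = there (∈-++ˡ v∈)

∈-++ˡ⁻ : ∀ {a b} (s : Subset a) {t : Subset b} {v : Fin a} → v ↑ˡ b ∈ s ++ᵛ t → v ∈ s
∈-++ˡ⁻ (_ ∷ s) {v = zero} here = here
∈-++ˡ⁻ (_ ∷ s) {v = suc v} (there v∈) = there (∈-++ˡ⁻ s v∈)

∈-++ʳ : ∀ {a b} (s : Subset a) {t : Subset b} {v : Fin b} → v ∈ t → a ↑ʳ v ∈ s ++ᵛ t
∈-++ʳ [] v∈ = v∈
∈-++ʳ (_ ∷ s) v∈ = there (∈-++ʳ s v∈)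

∈-++ʳ⁻ : ∀ {a b} (s : Subset a) {t : Subset b} {v : Fin b} → a ↑ʳ v ∈ s ++ᵛ t → v ∈ t
∈-++ʳ⁻ [] v∈ = v∈
∈-++ʳ⁻ (_ ∷ s) (there v∈) = ∈-++ʳ⁻ s v∈

-- The p pairs {i, p + i} are joined to each of the q remaining vertices.
module Construction (p q : ℕ) where

  edge : Fin p → Fin q → Subset (p + (p + q))
  edge i j = ⁅ i ⁆ ++ᵛ (⁅ i ⁆ ++ᵛ ⁅ j ⁆)

  low : Fin p → Fin (p + (p + q))
  low i = i ↑ˡ (p + q)

  high : Fin p → Fin (p + (p + q))
  high i = p ↑ʳ (i ↑ˡ q)

  free : Fin q → Fin (p + (p + q))
  free j = p ↑ʳ (p ↑ʳ j)

  low∈ : ∀ i j {k} → low k ∈ edge i j → k ≡ i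
  low∈ i j v∈ = x∈⁅y⁆⇒x≡y i (∈-++ˡ⁻ ⁅ i ⁆ v∈)

  high∈ : ∀ i j {k} → high k ∈ edge i j → k ≡ i
  high∈ i j v∈ = x∈⁅y⁆⇒x≡y i (∈-++ˡ⁻ ⁅ i ⁆ (∈-++ʳ⁻ ⁅ i ⁆ v∈))

  free∈ : ∀ i j {k} → free k ∈ edge i j → k ≡ j
  free∈ i j v∈ = x∈⁅y⁆⇒x≡y j (∈-++ʳ⁻ ⁅ i ⁆ (∈-++ʳ⁻ ⁅ i ⁆ v∈))

  ∈low : ∀ i j → low i ∈ edge i j
  ∈low i j = ∈-++ˡ (x∈⁅x⁆ i)

  ∈free : ∀ i j → free j ∈ edge i j
  ∈free i j = ∈-++ʳ ⁅ i ⁆ (∈-++ʳ ⁅ i ⁆ (x∈⁅x⁆ j))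

  edge-injective : ∀ {i j i′ j′} → edge i j ≡ edge i′ j′ → i ≡ i′ × j ≡ j′
  edge-injective {i} {j} {i′} {j′} eq =
    low∈ i′ j′ (subst (low i ∈_) eq (∈low i j)) , free∈ i′ j′ (subst (free j ∈_) eq (∈free i j))

  ∣edge∣ : ∀ i j → ∣ edge i j ∣ ≡ 3
  ∣edge∣ i j = trans (∣++∣ ⁅ i ⁆ _) (cong₂ _+_ (∣⁅x⁆∣≡1 i)
    (trans (∣++∣ ⁅ i ⁆ _) (cong₂ _+_ (∣⁅x⁆∣≡1 i) (∣⁅x⁆∣≡1 j))))

  E₀ : List (Subset (p + (p + q)))
  E₀ = cartesianProductWith edge (allFin p) (allFin q)

  ∈E₀⁻ : ∀ {e} → e ∈ˡ E₀ → ∃[ i ] ∃[ j ] e ≡ edge i j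
  ∈E₀⁻ e∈ = let i , j , _ , _ , eq = ∈-cartesianProductWith⁻ edge (allFin p) (allFin q) e∈ in i , j , eq

  H₀ : ThreeGraph (p + (p + q))
  H₀ = record
    { edges    = E₀
    ; uniform  = All.tabulate λ e∈ → let i , j , eq = ∈E₀⁻ e∈ in trans (cong ∣_∣ eq) (∣edge∣ i j)
    ; distinct = Uniqueₚ.cartesianProductWith⁺ edge edge-injective (Uniqueₚ.allFin⁺ p) (Uniqueₚ.allFin⁺ q)
    }

  length-E₀ : length E₀ ≡ p * q
  length-E₀ = trans (length-cartesianProductWith edge (allFin p) (allFin q))
    (cong₂ _*_ (length-tabulate {n = p} id) (length-tabulate {n = q} id))

  ∣edge∩edge∣ : ∀ i j i′ j′ → ∣ edge i j ∩ edge i′ j′ ∣ ≡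
    ∣ ⁅ i ⁆ ∩ ⁅ i′ ⁆ ∣ + (∣ ⁅ i ⁆ ∩ ⁅ i′ ⁆ ∣ + ∣ ⁅ j ⁆ ∩ ⁅ j′ ⁆ ∣)
  ∣edge∩edge∣ i j i′ j′ = trans
    (cong ∣_∣ (trans (zipWith-++ _ ⁅ i ⁆ _ ⁅ i′ ⁆ _) (cong (⁅ i ⁆ ∩ ⁅ i′ ⁆ ++ᵛ_) (zipWith-++ _ ⁅ i ⁆ _ ⁅ i′ ⁆ _))))
    (trans (∣++∣ (⁅ i ⁆ ∩ ⁅ i′ ⁆) _) (cong (∣ ⁅ i ⁆ ∩ ⁅ i′ ⁆ ∣ +_) (∣++∣ (⁅ i ⁆ ∩ ⁅ i′ ⁆) _)))

  -- A common pair contributes two to the intersection and a common free vertex contributes one. A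
  -- total of 1 is odd, so it comes from the free vertex.
  meet-once : ∀ {i j i′ j′} → ∣ edge i j ∩ edge i′ j′ ∣ ≡ 1 → j ≡ j′
  meet-once {i} {j} {i′} {j′} eq =
    let v , v∈ = element (⁅ j ⁆ ∩ ⁅ j′ ⁆) (odd ∣ ⁅ i ⁆ ∩ ⁅ i′ ⁆ ∣ _ (trans (sym (∣edge∩edge∣ i j i′ j′)) eq))
        v∈j , v∈j′ = x∈p∩q⁻ ⁅ j ⁆ ⁅ j′ ⁆ v∈
    in trans (sym (x∈⁅y⁆⇒x≡y j v∈j)) (x∈⁅y⁆⇒x≡y j′ v∈j′)
    where
    odd : ∀ a b → a + (a + b) ≡ 1 → b ≡ 1
    odd zero b eq = eq
    odd (suc a) b eq = contradiction (m+n≡0⇒n≡0 a (suc-injective eq)) λ ()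

  -- By `meet-once` consecutive edges of a path share their free vertex, hence so do the first and
  -- the last, which should be disjoint.
  H₀-free : P33Free H₀
  H₀-free (_ , _ , _ , e∈ , f∈ , g∈ , ef , fg , eg) with ∈E₀⁻ e∈ | ∈E₀⁻ f∈ | ∈E₀⁻ g∈
  ... | i , j , refl | i′ , j′ , refl | i″ , j″ , refl with meet-once {i} {j} {i′} {j′} ef | meet-once {i′} {j′} {i″} {j″} fg
  ...   | refl | refl = ∣p∣≡0⇒∉ (edge i j ∩ edge i″ j) eg (x∈p∩q⁺ (∈free i j , ∈free i″ j))

  -- The vertices `end k` label the edges at `v`: every edge carries a label, and a label together
  -- with `v` determines the edge. For `v` in a pair the labels are the free vertices; for a free
  -- `v` they are the low members of the pairs.
  deg-E₀-≤ : ∀ {m} (v : Fin (p + (p + q))) (end : Fin m → Fin (p + (p + q))) →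
    (∀ i j → ∃[ k ] end k ∈ edge i j) →
    (∀ k i j i′ j′ → v ∈ edge i j → v ∈ edge i′ j′ → end k ∈ edge i j → end k ∈ edge i′ j′ →
      i ≡ i′ × j ≡ j′) →
    deg v E₀ ≤ m
  deg-E₀-≤ {m} v end some determined = subst₂ _≤_ (*-identityʳ _)
    (trans (*-identityʳ _) (trans (length-map end (allFin m)) (length-tabulate {n = m} id)))
    (double-count (map end (allFin m)) (filter (v ∈?_) E₀) meets single)
    where
    meets : ∀ {e} → e ∈ˡ filter (v ∈?_) E₀ → 1 ≤ hits (map end (allFin m)) e
    meets e∈ with ∈E₀⁻ (proj₁ (∈-filter⁻ (v ∈?_) {xs = E₀} e∈))
    ... | i , j , refl = let k , k∈ = some i j in 1≤hits (∈-map⁺ end (∈-allFin k)) k∈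
    single : ∀ {u} → u ∈ˡ map end (allFin m) → deg u (filter (v ∈?_) E₀) ≤ 1
    single u∈ with ∈-map⁻ end u∈
    ... | k , _ , refl = deg-filter≤1 (v ∈?_) (end k) (distinct H₀) λ e∈ f∈ v∈e v∈f k∈e k∈f →
      same (∈E₀⁻ e∈) (∈E₀⁻ f∈) v∈e v∈f k∈e k∈f
      where
      same : ∀ {e f} → ∃[ i ] ∃[ j ] e ≡ edge i j → ∃[ i ] ∃[ j ] f ≡ edge i j →
        v ∈ e → v ∈ f → end k ∈ e → end k ∈ f → e ≡ f
      same (i , j , refl) (i′ , j′ , refl) v∈e v∈f k∈e k∈f =
        let i≡i′ , j≡j′ = determined k i j i′ j′ v∈e v∈f k∈e k∈f in cong₂ edge i≡i′ j≡j′

  deg-E₀ : ∀ v → deg v E₀ ≤ p ⊎ deg v E₀ ≤ q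
  deg-E₀ v with splitAt p v in eq
  ... | inj₁ i with refl ← splitAt⁻¹-↑ˡ eq = inj₂ (deg-E₀-≤ (low i) free (λ i j → j , ∈free i j)
      λ _ i j i′ j′ v∈e v∈f u∈e u∈f → trans (sym (low∈ i j v∈e)) (low∈ i′ j′ v∈f) ,
      trans (sym (free∈ i j u∈e)) (free∈ i′ j′ u∈f))
  ... | inj₂ w with refl ← splitAt⁻¹-↑ʳ {m = p} eq with splitAt p w in eq′
  ...   | inj₁ i with refl ← splitAt⁻¹-↑ˡ eq′ = inj₂ (deg-E₀-≤ (high i) free (λ i j → j , ∈free i j)
      λ _ i j i′ j′ v∈e v∈f u∈e u∈f → trans (sym (high∈ i j v∈e)) (high∈ i′ j′ v∈f) ,
      trans (sym (free∈ i j u∈e)) (free∈ i′ j′ u∈f))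
  ...   | inj₂ j with refl ← splitAt⁻¹-↑ʳ {m = p} eq′ = inj₁ (deg-E₀-≤ (free j) low (λ i j → i , ∈low i j)
      λ _ i j i′ j′ v∈e v∈f u∈e u∈f → trans (sym (low∈ i j u∈e)) (low∈ i′ j′ u∈f) ,
      trans (sym (free∈ i j v∈e)) (free∈ i′ j′ v∈f))

  maxDegree-H₀ : ∀ {d} → p ≤ d → q ≤ d → maxDegree H₀ ≤ d
  maxDegree-H₀ {d} p≤d q≤d = foldr-⊔-≤ (degree H₀) (allFin (p + (p + q))) bound
    where
    bound : ∀ v → degree H₀ v ≤ d
    bound v with deg-E₀ v
    ... | inj₁ ≤p = ≤-trans ≤p p≤d
    ... | inj₂ ≤q = ≤-trans ≤q q≤d

-- Parameters for each residue modulo 4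

Extremal : ℕ → Set
Extremal n = ∃[ H₀ ] (P33Free {n} H₀ × numEdges H₀ ≡ (n * n) / 8 × maxDegree H₀ ≤ (n + 1) / 2)

-- Since n = 2p + q, the remainder n² - 8pq is the square of 2p - q. Taking p near n / 4 keeps this
-- below 8, so pq is exactly the rounded-down n² / 8; `extremal` uses the remainders 0, 1, 4 and 1.
construct : ∀ n p q r → p + (p + q) ≡ n → r < 8 → n * n ≡ r + p * q * 8 → p * 2 ≤ n + 1 → q * 2 ≤ n + 1 → Extremal n
construct n p q r refl r<8 n²≡ 2p≤ 2q≤ = H₀ , H₀-free , trans length-E₀ (sym quotient) , maxDegree-H₀ (half 2p≤) (half 2q≤)
  where
  open Construction p q
  quotient : (n * n) / 8 ≡ p * q
  quotient = trans (cong (_/ 8) n²≡) (trans (+-distrib-/-∣ʳ r (n∣m*n (p * q)))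
    (cong₂ _+_ (m<n⇒m/n≡0 r<8) (m*n/n≡m (p * q) 8)))
  half : ∀ {m} → m * 2 ≤ n + 1 → m ≤ (n + 1) / 2
  half {m} 2m≤ = subst (_≤ (n + 1) / 2) (m*n/n≡m m 2) (/-monoˡ-≤ 2 2m≤)

extremal : ∀ r k → r < 4 → Extremal (r + k * 4)
extremal 0 k _ = construct _ k (2 * k) 0
  (solve 1 (λ k → k :+ (k :+ con 2 :* k) := k :* con 4) refl k) (s≤s z≤n)
  (solve 1 (λ k → k :* con 4 :* (k :* con 4) := k :* (con 2 :* k) :* con 8) refl k)
  (m+n≤o⇒m≤o (k * 2) (≤-reflexive (solve 1 (λ k → k :* con 2 :+ (k :* con 2 :+ con 1) := k :* con 4 :+ con 1) refl k)))
  (m+n≤o⇒m≤o (2 * k * 2) (≤-reflexive (solve 1 (λ k → con 2 :* k :* con 2 :+ con 1 := k :* con 4 :+ con 1) refl k)))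
  where open +-*-Solver
extremal 1 k _ = construct _ k (1 + 2 * k) 1
  (solve 1 (λ k → k :+ (k :+ (con 1 :+ con 2 :* k)) := con 1 :+ k :* con 4) refl k) (s≤s (s≤s z≤n))
  (solve 1 (λ k → (con 1 :+ k :* con 4) :* (con 1 :+ k :* con 4) := con 1 :+ k :* (con 1 :+ con 2 :* k) :* con 8) refl k)
  (m+n≤o⇒m≤o (k * 2) (≤-reflexive (solve 1 (λ k → k :* con 2 :+ (k :* con 2 :+ con 2) := con 1 :+ k :* con 4 :+ con 1) refl k)))
  (≤-reflexive (solve 1 (λ k → (con 1 :+ con 2 :* k) :* con 2 := con 1 :+ k :* con 4 :+ con 1) refl k))
  where open +-*-Solver
extremal 2 k _ = construct _ (1 + k) (2 * k) 4
  (solve 1 (λ k → con 1 :+ k :+ (con 1 :+ k :+ con 2 :* k) := con 2 :+ k :* con 4) refl k) (m≤m+n 5 3)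
  (solve 1 (λ k → (con 2 :+ k :* con 4) :* (con 2 :+ k :* con 4) := con 4 :+ (con 1 :+ k) :* (con 2 :* k) :* con 8) refl k)
  (m+n≤o⇒m≤o ((1 + k) * 2) (≤-reflexive (solve 1 (λ k → (con 1 :+ k) :* con 2 :+ (k :* con 2 :+ con 1) := con 2 :+ k :* con 4 :+ con 1) refl k)))
  (m+n≤o⇒m≤o (2 * k * 2) (≤-reflexive (solve 1 (λ k → con 2 :* k :* con 2 :+ con 3 := con 2 :+ k :* con 4 :+ con 1) refl k)))
  where open +-*-Solver
extremal 3 k _ = construct _ (1 + k) (1 + 2 * k) 1
  (solve 1 (λ k → con 1 :+ k :+ (con 1 :+ k :+ (con 1 :+ con 2 :* k)) := con 3 :+ k :* con 4) refl k) (s≤s (s≤s z≤n))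
  (solve 1 (λ k → (con 3 :+ k :* con 4) :* (con 3 :+ k :* con 4) := con 1 :+ (con 1 :+ k) :* (con 1 :+ con 2 :* k) :* con 8) refl k)
  (m+n≤o⇒m≤o ((1 + k) * 2) (≤-reflexive (solve 1 (λ k → (con 1 :+ k) :* con 2 :+ (k :* con 2 :+ con 2) := con 3 :+ k :* con 4 :+ con 1) refl k)))
  (m+n≤o⇒m≤o ((1 + 2 * k) * 2) (≤-reflexive (solve 1 (λ k → (con 1 :+ con 2 :* k) :* con 2 :+ con 2 := con 3 :+ k :* con 4 :+ con 1) refl k)))
  where open +-*-Solver
extremal (suc (suc (suc (suc _)))) _ (s≤s (s≤s (s≤s (s≤s ()))))

theorem2 : (∃[ n₂ ] ∀ (n : ℕ) → n₂ ≤ n → (H : ThreeGraph n) → P33Free H →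
    n * n + 8 ≤ 8 * numEdges H →
    n * n ≤ 32 * maxDegree H + 32 * n)
    × (∀ (n : ℕ) → 4 ≤ n → ∃[ H₀ ] (P33Free {n} H₀ ×
    numEdges H₀ ≡ (n * n) / 8 × maxDegree H₀ ≤ (n + 1) / 2))
theorem2 = (1000 , large-degree) , λ n _ →
  subst Extremal (sym (m≡m%n+[m/n]*n n 4)) (extremal (n % 4) (n / 4) (m%n<n n 4))
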